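{- Let $K$ and $S$ be Kleene algebras. If the semiring reducts of $K$ and $S$ are Morita-equivalent via semiring bimodules, then $K$ and $S$ are Morita-equivalent via Kleene bimodules. Explicitly: if there exist a semiring $(K,S)$-bimodule $P$ and a semiring $(S,K)$-bimodule $Q$ with $P\otimes_S Q\cong {}_KK_K$ and $Q\otimes_K P\cong {}_SS_S$ as bimodules, then there exist a Kleene $(K,S)$-bimodule $M$ and a Kleene $(S,K)$-bimodule $N$ with $M\otimes_S N\cong {}_KK_K$ and $N\otimes_K M\cong {}_SS_S$ as bimodules.
   Context: A semiring $\langle S,+,\cdot,0,1\rangle$ is unital: $\langle S,+,0\rangle$ is a commutative monoid, $\langle S,\cdot,1\rangle$ is a monoid, $s0=0s=0$ for all $s$, and multiplication distributes over addition on both sides. A left module over a semiring $S$ is a commutative monoid $\langle M,+,0\rangle$ with a map $S\times M\to M$ satisfying $s(m+n)=sm+sn$, $(s+t)m=sm+tm$, $s(tm)=(st)m$, $1m=m$, $0m=0$; right modules are defined symmetrically. An $(S,T)$-bimodule is a left $S$-module and right $T$-module on the same commutative monoid with $s(mt)=(sm)t$. Homomorphisms are maps preserving addition and the scalar action(s); isomorphisms are invertible homomorphisms. A Kleene algebra is an additively idempotent semiring $K$ ($x+x=x$), ordered by $x\le y\iff x+y=y$, with a unary operation $*$ such that for all $x,y,z$: $1+xx^*=1+x^*x=x^*$; if $x+yz\le z$ then $y^*x\le z$; if $x+zy\le z$ then $xy^*\le z$. Its semiring reduct is obtained by forgetting $*$. Modules over an additively idempotent semiring are additively idempotent and are ordered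 in the same way. A left Kleene module over $K$ is a left module $M$ over the semiring reduct of $K$ such that $am\le m\Rightarrow a^*m\le m$ for all $a\in K$, $m\in M$; a right Kleene module is defined symmetrically ($ma\le m\Rightarrow ma^*\le m$). A Kleene $(K,L)$-bimodule is a semiring $(K,L)$-bimodule that is both a left Kleene module over $K$ and a right Kleene module over $L$. Tensor product: for an $(A,B)$-bimodule $M$ and a $(B,C)$-bimodule $N$, $M\otimes_B N$ is the quotient of the commutative monoid of finite formal sums of pairs $(m,n)\in M\times N$ by the least congruence under which the class $m\otimes n$ of $(m,n)$ is additive in each variable (with $0\otimes n=m\otimes 0=0$) and $B$-balanced, $mb\otimes n=m\otimes bn$; it is an $(A,C)$-bimodule via $a(m\otimes n)=(am)\otimes n$ and $(m\otimes n)c=m\otimes(nc)$. ${}_KK_K$ denotes $K$ as a bimodule over itself by multiplication. -}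

module Defs where

open import Algebra.Bundles using (Semiring; IdempotentSemiring)
open import Algebra.Core using (Op₁; Op₂)
open import Algebra.Module.Bundles using (LeftSemimodule; RightSemimodule; Bisemimodule)
open import Algebra.Module.Morphism.Structures using (IsBisemimoduleIsomorphism)
open import Data.List.Base using (List; []; _∷_; [_]; _++_; map)
open import Data.List.Properties using (++-assoc; ++-identityʳ; map-++)
open import Data.Product.Base using (Σ; _×_; _,_; map₁; map₂)
open import Level using (Level; _⊔_; suc)
open import Relation.Binary.Core using (Rel)
import Relation.Binary.PropositionalEquality.Core as ≡

private
  variable
    a ℓa b ℓb c ℓc m ℓm n ℓn ℓ : Level

NaturalOrder : {A : Set a} → Rel A ℓ → Op₂ A → Rel A ℓ
NaturalOrder _≈_ _+_ x y = (x + y) ≈ y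

-- Algebra.Bundles.KleeneAlgebra is not used: its induction axioms are stated
-- for equalities (b + a * x ≈ x → a ⋆ * b ≈ x), and the instance a = 1#,
-- b = 0# then forces every element to be 0#.

-- That _⋆ respects _≈_ is a consequence of these axioms: if x ≈ y then
-- 1# + x * y ⋆ ≤ y ⋆, whence x ⋆ ≤ y ⋆, and symmetrically.

record KleeneAlgebra c ℓ : Set (suc (c ⊔ ℓ)) where
  infix 8 _⋆
  infix 4 _≤_

  field
    idempotentSemiring : IdempotentSemiring c ℓ

  open IdempotentSemiring idempotentSemiring public

  _≤_ : Rel Carrier ℓ
  _≤_ = NaturalOrder _≈_ _+_

  field
    _⋆          : Op₁ Carrier
    ⋆-unfoldʳ   : ∀ x → 1# + x * x ⋆ ≈ x ⋆
    ⋆-unfoldˡ   : ∀ x → 1# + x ⋆ * x ≈ x ⋆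
    ⋆-inductˡ   : ∀ x y z → x + y * z ≤ z → y ⋆ * x ≤ z
    ⋆-inductʳ   : ∀ x y z → x + z * y ≤ z → x * y ⋆ ≤ z

module _ (K : KleeneAlgebra a ℓa) where
  open KleeneAlgebra K using (Carrier; semiring; _⋆)

  IsLeftKleeneModule : LeftSemimodule semiring m ℓm → Set (a ⊔ m ⊔ ℓm)
  IsLeftKleeneModule M =
    ∀ (x : Carrier) (m : Carrierᴹ) → (x *ₗ m) ≤ᴹ m → (x ⋆ *ₗ m) ≤ᴹ m
    where
    open LeftSemimodule M
    _≤ᴹ_ = NaturalOrder _≈ᴹ_ _+ᴹ_

  IsRightKleeneModule : RightSemimodule semiring m ℓm → Set (a ⊔ m ⊔ ℓm)
  IsRightKleeneModule M =
    ∀ (x : Carrier) (m : Carrierᴹ) → (m *ᵣ x) ≤ᴹ m → (m *ᵣ x ⋆) ≤ᴹ m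
    where
    open RightSemimodule M
    _≤ᴹ_ = NaturalOrder _≈ᴹ_ _+ᴹ_

record KleeneBimodule (K : KleeneAlgebra a ℓa) (L : KleeneAlgebra b ℓb) m ℓm
                      : Set (a ⊔ ℓa ⊔ b ⊔ ℓb ⊔ suc (m ⊔ ℓm)) where
  field
    bisemimodule : Bisemimodule (KleeneAlgebra.semiring K) (KleeneAlgebra.semiring L) m ℓm

  open Bisemimodule bisemimodule public

  field
    isLeftKleeneModule  : IsLeftKleeneModule K leftSemimodule
    isRightKleeneModule : IsRightKleeneModule L rightSemimodule

-- IsBisemimoduleIsomorphism asks for injectivity and surjectivity. Surjectivity
-- supplies preimages, so the inverse map is available.

infix 4 _≅_

_≅_ : {A : Semiring a ℓa} {B : Semiring b ℓb} →
      Bisemimodule A B m ℓm → Bisemimodule A B n ℓn → Set (a ⊔ b ⊔ m ⊔ ℓm ⊔ n ⊔ ℓn)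
M ≅ N = Σ (M.Carrierᴹ → N.Carrierᴹ)
          (IsBisemimoduleIsomorphism M.rawBisemimodule N.rawBisemimodule)
  where
  module M = Bisemimodule M
  module N = Bisemimodule N

module TensorProduct
  {A : Semiring a ℓa} {B : Semiring b ℓb} {C : Semiring c ℓc}
  (M : Bisemimodule A B m ℓm) (N : Bisemimodule B C n ℓn)
  where

  private
    module A = Semiring A
    module B = Semiring B
    module C = Semiring C
    module M = Bisemimodule M
    module N = Bisemimodule N

  FormalSum : Set (m ⊔ n)
  FormalSum = List (M.Carrierᴹ × N.Carrierᴹ)

  infix 4 _∼_

  -- Lists under _++_ form the free monoid, so ++-comm is what makes the
  -- quotient a commutative monoid; ⊗-cong is needed because the carriers of M
  -- and N are setoids.

  data _∼_ : Rel FormalSum (b ⊔ m ⊔ ℓm ⊔ n ⊔ ℓn) where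
    ∼-refl     : ∀ {xs} → xs ∼ xs
    ∼-sym      : ∀ {xs ys} → xs ∼ ys → ys ∼ xs
    ∼-trans    : ∀ {xs ys zs} → xs ∼ ys → ys ∼ zs → xs ∼ zs
    ++-cong    : ∀ {xs xs′ ys ys′} → xs ∼ xs′ → ys ∼ ys′ → xs ++ ys ∼ xs′ ++ ys′
    ++-comm    : ∀ xs ys → xs ++ ys ∼ ys ++ xs
    ⊗-cong     : ∀ {x x′ y y′} → x M.≈ᴹ x′ → y N.≈ᴹ y′ → [ x , y ] ∼ [ x′ , y′ ]
    ⊗-distribʳ : ∀ x x′ y → [ x M.+ᴹ x′ , y ] ∼ (x , y) ∷ (x′ , y) ∷ []
    ⊗-distribˡ : ∀ x y y′ → [ x , y N.+ᴹ y′ ] ∼ (x , y) ∷ (x , y′) ∷ []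
    ⊗-zeroˡ    : ∀ y → [ M.0ᴹ , y ] ∼ []
    ⊗-zeroʳ    : ∀ x → [ x , N.0ᴹ ] ∼ []
    ⊗-balanced : ∀ x s y → [ x M.*ᵣ s , y ] ∼ [ x , s N.*ₗ y ]

  infixr 7 _·ₗ_
  infixl 7 _·ᵣ_

  _·ₗ_ : A.Carrier → FormalSum → FormalSum
  s ·ₗ xs = map (map₁ (s M.*ₗ_)) xs

  _·ᵣ_ : FormalSum → C.Carrier → FormalSum
  xs ·ᵣ t = map (map₂ (N._*ᵣ t)) xs

  private
    reflexive : ∀ {xs ys} → xs ≡.≡ ys → xs ∼ ys
    reflexive ≡.refl = ∼-refl

    ∷-cong : ∀ {x y xs ys} → [ x ] ∼ [ y ] → xs ∼ ys → x ∷ xs ∼ y ∷ ys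
    ∷-cong = ++-cong

    -- x + (xs + (y + ys)) ∼ (x + y) + (xs + ys)
    interchange : ∀ x y xs ys → x ∷ y ∷ xs ++ ys ∼ (x ∷ xs) ++ (y ∷ ys)
    interchange x y xs ys = ∷-cong ∼-refl
      (∼-trans (++-cong (++-comm [ y ] xs) (∼-refl {ys}))
               (reflexive (++-assoc xs [ y ] ys)))

    ·ₗ-congˡ : ∀ s {xs ys} → xs ∼ ys → s ·ₗ xs ∼ s ·ₗ ys
    ·ₗ-congˡ s ∼-refl = ∼-refl
    ·ₗ-congˡ s (∼-sym p) = ∼-sym (·ₗ-congˡ s p)
    ·ₗ-congˡ s (∼-trans p q) = ∼-trans (·ₗ-congˡ s p) (·ₗ-congˡ s q)
    ·ₗ-congˡ s (++-cong {xs} {xs′} {ys} {ys′} p q) =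
      ∼-trans (reflexive (map-++ _ xs ys))
        (∼-trans (++-cong (·ₗ-congˡ s p) (·ₗ-congˡ s q))
                 (reflexive (≡.sym (map-++ _ xs′ ys′))))
    ·ₗ-congˡ s (++-comm xs ys) =
      ∼-trans (reflexive (map-++ _ xs ys))
        (∼-trans (++-comm (s ·ₗ xs) (s ·ₗ ys))
                 (reflexive (≡.sym (map-++ _ ys xs))))
    ·ₗ-congˡ s (⊗-cong p q) = ⊗-cong (M.*ₗ-congˡ p) q
    ·ₗ-congˡ s (⊗-distribʳ x x′ y) =
      ∼-trans (⊗-cong (M.*ₗ-distribˡ s x x′) N.≈ᴹ-refl) (⊗-distribʳ _ _ y)
    ·ₗ-congˡ s (⊗-distribˡ x y y′) = ⊗-distribˡ _ y y′
    ·ₗ-congˡ s (⊗-zeroˡ y) = ∼-trans (⊗-cong (M.*ₗ-zeroʳ s) N.≈ᴹ-refl) (⊗-zeroˡ y)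
    ·ₗ-congˡ s (⊗-zeroʳ x) = ⊗-zeroʳ _
    ·ₗ-congˡ s (⊗-balanced x t y) =
      ∼-trans (⊗-cong (M.≈ᴹ-sym (M.*ₗ-*ᵣ-assoc s x t)) N.≈ᴹ-refl) (⊗-balanced _ t y)

    ·ᵣ-congʳ : ∀ t {xs ys} → xs ∼ ys → xs ·ᵣ t ∼ ys ·ᵣ t
    ·ᵣ-congʳ t ∼-refl = ∼-refl
    ·ᵣ-congʳ t (∼-sym p) = ∼-sym (·ᵣ-congʳ t p)
    ·ᵣ-congʳ t (∼-trans p q) = ∼-trans (·ᵣ-congʳ t p) (·ᵣ-congʳ t q)
    ·ᵣ-congʳ t (++-cong {xs} {xs′} {ys} {ys′} p q) =
      ∼-trans (reflexive (map-++ _ xs ys))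
        (∼-trans (++-cong (·ᵣ-congʳ t p) (·ᵣ-congʳ t q))
                 (reflexive (≡.sym (map-++ _ xs′ ys′))))
    ·ᵣ-congʳ t (++-comm xs ys) =
      ∼-trans (reflexive (map-++ _ xs ys))
        (∼-trans (++-comm (xs ·ᵣ t) (ys ·ᵣ t))
                 (reflexive (≡.sym (map-++ _ ys xs))))
    ·ᵣ-congʳ t (⊗-cong p q) = ⊗-cong p (N.*ᵣ-congʳ q)
    ·ᵣ-congʳ t (⊗-distribʳ x x′ y) = ⊗-distribʳ x x′ _
    ·ᵣ-congʳ t (⊗-distribˡ x y y′) =
      ∼-trans (⊗-cong M.≈ᴹ-refl (N.*ᵣ-distribʳ t y y′)) (⊗-distribˡ x _ _)
    ·ᵣ-congʳ t (⊗-zeroˡ y) = ⊗-zeroˡ _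
    ·ᵣ-congʳ t (⊗-zeroʳ x) = ∼-trans (⊗-cong M.≈ᴹ-refl (N.*ᵣ-zeroˡ t)) (⊗-zeroʳ x)
    ·ᵣ-congʳ t (⊗-balanced x s y) =
      ∼-trans (⊗-balanced x s _) (⊗-cong M.≈ᴹ-refl (N.≈ᴹ-sym (N.*ₗ-*ᵣ-assoc s y t)))

    ·ₗ-congʳ : ∀ {s t} → s A.≈ t → ∀ xs → s ·ₗ xs ∼ t ·ₗ xs
    ·ₗ-congʳ s≈t []       = ∼-refl
    ·ₗ-congʳ s≈t (_ ∷ xs) = ∷-cong (⊗-cong (M.*ₗ-congʳ s≈t) N.≈ᴹ-refl) (·ₗ-congʳ s≈t xs)

    ·ₗ-zeroˡ : ∀ xs → A.0# ·ₗ xs ∼ []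
    ·ₗ-zeroˡ []             = ∼-refl
    ·ₗ-zeroˡ ((x , y) ∷ xs) =
      ++-cong (∼-trans (⊗-cong (M.*ₗ-zeroˡ x) N.≈ᴹ-refl) (⊗-zeroˡ y)) (·ₗ-zeroˡ xs)

    ·ₗ-distribʳ : ∀ xs s t → (s A.+ t) ·ₗ xs ∼ s ·ₗ xs ++ t ·ₗ xs
    ·ₗ-distribʳ []             s t = ∼-refl
    ·ₗ-distribʳ ((x , y) ∷ xs) s t =
      ∼-trans (++-cong (∼-trans (⊗-cong (M.*ₗ-distribʳ x s t) N.≈ᴹ-refl) (⊗-distribʳ _ _ y))
                       (·ₗ-distribʳ xs s t))
              (interchange _ _ (s ·ₗ xs) (t ·ₗ xs))

    ·ₗ-identityˡ : ∀ xs → A.1# ·ₗ xs ∼ xs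
    ·ₗ-identityˡ []             = ∼-refl
    ·ₗ-identityˡ ((x , y) ∷ xs) =
      ∷-cong (⊗-cong (M.*ₗ-identityˡ x) N.≈ᴹ-refl) (·ₗ-identityˡ xs)

    ·ₗ-assoc : ∀ s t xs → (s A.* t) ·ₗ xs ∼ s ·ₗ t ·ₗ xs
    ·ₗ-assoc s t []             = ∼-refl
    ·ₗ-assoc s t ((x , y) ∷ xs) =
      ∷-cong (⊗-cong (M.*ₗ-assoc s t x) N.≈ᴹ-refl) (·ₗ-assoc s t xs)

    ·ᵣ-congˡ : ∀ {s t} → s C.≈ t → ∀ xs → xs ·ᵣ s ∼ xs ·ᵣ t
    ·ᵣ-congˡ s≈t []       = ∼-refl
    ·ᵣ-congˡ s≈t (_ ∷ xs) = ∷-cong (⊗-cong M.≈ᴹ-refl (N.*ᵣ-congˡ s≈t)) (·ᵣ-congˡ s≈t xs)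

    ·ᵣ-zeroʳ : ∀ xs → xs ·ᵣ C.0# ∼ []
    ·ᵣ-zeroʳ []             = ∼-refl
    ·ᵣ-zeroʳ ((x , y) ∷ xs) =
      ++-cong (∼-trans (⊗-cong M.≈ᴹ-refl (N.*ᵣ-zeroʳ y)) (⊗-zeroʳ x)) (·ᵣ-zeroʳ xs)

    ·ᵣ-distribˡ : ∀ xs s t → xs ·ᵣ (s C.+ t) ∼ xs ·ᵣ s ++ xs ·ᵣ t
    ·ᵣ-distribˡ []             s t = ∼-refl
    ·ᵣ-distribˡ ((x , y) ∷ xs) s t =
      ∼-trans (++-cong (∼-trans (⊗-cong M.≈ᴹ-refl (N.*ᵣ-distribˡ y s t)) (⊗-distribˡ x _ _))
                       (·ᵣ-distribˡ xs s t))
              (interchange _ _ (xs ·ᵣ s) (xs ·ᵣ t))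

    ·ᵣ-identityʳ : ∀ xs → xs ·ᵣ C.1# ∼ xs
    ·ᵣ-identityʳ []             = ∼-refl
    ·ᵣ-identityʳ ((x , y) ∷ xs) =
      ∷-cong (⊗-cong M.≈ᴹ-refl (N.*ᵣ-identityʳ y)) (·ᵣ-identityʳ xs)

    ·ᵣ-assoc : ∀ xs s t → (xs ·ᵣ s) ·ᵣ t ∼ xs ·ᵣ (s C.* t)
    ·ᵣ-assoc []             s t = ∼-refl
    ·ᵣ-assoc ((x , y) ∷ xs) s t =
      ∷-cong (⊗-cong M.≈ᴹ-refl (N.*ᵣ-assoc y s t)) (·ᵣ-assoc xs s t)

    ·ₗ-·ᵣ-assoc : ∀ s xs t → (s ·ₗ xs) ·ᵣ t ∼ s ·ₗ (xs ·ᵣ t)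
    ·ₗ-·ᵣ-assoc s []       t = ∼-refl
    ·ₗ-·ᵣ-assoc s (_ ∷ xs) t = ∷-cong ∼-refl (·ₗ-·ᵣ-assoc s xs t)

  tensorProduct : Bisemimodule A C (m ⊔ n) (b ⊔ m ⊔ ℓm ⊔ n ⊔ ℓn)
  tensorProduct = record
    { Carrierᴹ = FormalSum
    ; _≈ᴹ_ = _∼_
    ; _+ᴹ_ = _++_
    ; _*ₗ_ = _·ₗ_
    ; _*ᵣ_ = _·ᵣ_
    ; 0ᴹ = []
    ; isBisemimodule = record
      { +ᴹ-isCommutativeMonoid = record
        { isMonoid = record
          { isSemigroup = record
            { isMagma = record
              { isEquivalence = record { refl = ∼-refl ; sym = ∼-sym ; trans = ∼-trans }
              ; ∙-cong = ++-cong
              }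
            ; assoc = λ xs ys zs → reflexive (++-assoc xs ys zs)
            }
          ; identity = (λ _ → ∼-refl) , (λ xs → reflexive (++-identityʳ xs))
          }
        ; comm = ++-comm
        }
      ; isPreleftSemimodule = record
        { *ₗ-cong = λ {s} {t} {xs} s≈t xs∼ys → ∼-trans (·ₗ-congʳ s≈t xs) (·ₗ-congˡ t xs∼ys)
        ; *ₗ-zeroˡ = ·ₗ-zeroˡ
        ; *ₗ-distribʳ = ·ₗ-distribʳ
        ; *ₗ-identityˡ = ·ₗ-identityˡ
        ; *ₗ-assoc = ·ₗ-assoc
        ; *ₗ-zeroʳ = λ _ → ∼-refl
        ; *ₗ-distribˡ = λ s xs ys → reflexive (map-++ _ xs ys)
        }
      ; isPrerightSemimodule = record
        { *ᵣ-cong = λ {xs} {ys} {s} {t} xs∼ys s≈t → ∼-trans (·ᵣ-congˡ s≈t xs) (·ᵣ-congʳ t xs∼ys)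
        ; *ᵣ-zeroʳ = ·ᵣ-zeroʳ
        ; *ᵣ-distribˡ = ·ᵣ-distribˡ
        ; *ᵣ-identityʳ = ·ᵣ-identityʳ
        ; *ᵣ-assoc = ·ᵣ-assoc
        ; *ᵣ-zeroˡ = λ _ → ∼-refl
        ; *ᵣ-distribʳ = λ t xs ys → reflexive (map-++ _ xs ys)
        }
      ; *ₗ-*ᵣ-assoc = ·ₗ-·ᵣ-assoc
      }
    }

infixl 7 _⊗_

_⊗_ : {A : Semiring a ℓa} {B : Semiring b ℓb} {C : Semiring c ℓc} →
      Bisemimodule A B m ℓm → Bisemimodule B C n ℓn →
      Bisemimodule A C (m ⊔ n) (b ⊔ m ⊔ ℓm ⊔ n ⊔ ℓn)
M ⊗ N = TensorProduct.tensorProduct M N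

{-# OPTIONS --safe #-}
module Submission where

-- M = P and N = Q already work. Write ⟨p,q⟩ ∈ K and ⟪q,p⟫ ∈ S for the images of
-- p ⊗ q and q ⊗ p, and pick Σ uⱼ ⊗ vⱼ ↦ 1 in K, Σ qᵢ ⊗ yᵢ ↦ 1 in S. The two
-- isomorphisms need not be associatively compatible, so θ p = Σ ⟨p,qᵢ⟩ yᵢ need
-- not be p, but θ is injective, with inverse η p = Σ uⱼ ⟪vⱼ,p⟫. Hence p is
-- determined by the coordinates ⟨p,qᵢ⟩, which depend K-linearly on p, and the
-- left Kleene law passes from K to P. On the other side the coordinates are the
-- ⟪vⱼ,p⟫. Exchanging P and Q gives the laws for Q.

open import Defs
open import Algebra.Bundles using (CommutativeMonoid; Semiring)
open import Algebra.Module.Bundles using (Bisemimodule)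
import Algebra.Module.Construct.TensorUnit as TensorUnit
import Algebra.Properties.CommutativeSemigroup as CommutativeSemigroupProperties
open import Data.List.Base using (List; []; _∷_; [_]; _++_; foldr; map)
open import Data.List.Properties using (foldr-map)
open import Data.Product using (Σ-syntax; _×_; _,_; proj₁; proj₂; map₁; map₂)
open import Level using (Level; _⊔_)
open import Algebra.Module.Morphism.Structures using (IsBisemimoduleIsomorphism)
import Relation.Binary.Reasoning.Setoid as SetoidReasoning

private
  variable
    a ℓa b ℓb c ℓc m ℓm n ℓn x ℓx i j : Level

-- Finite sums in commutative monoids.

module Sum (X : CommutativeMonoid x ℓx) where
  open CommutativeMonoid X
  open CommutativeSemigroupProperties commutativeSemigroup using (interchange)

  ∑ : {I : Set i} → (I → Carrier) → List I → Carrier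
  ∑ f = foldr (λ k s → f k ∙ s) ε

  module _ {I : Set i} where

    ∑-cong : {f g : I → Carrier} → (∀ k → f k ≈ g k) → ∀ ks → ∑ f ks ≈ ∑ g ks
    ∑-cong f≈g []       = refl
    ∑-cong f≈g (k ∷ ks) = ∙-cong (f≈g k) (∑-cong f≈g ks)

    ∑-++ : (f : I → Carrier) → ∀ ks ls → ∑ f (ks ++ ls) ≈ ∑ f ks ∙ ∑ f ls
    ∑-++ f []       ls = sym (identityˡ _)
    ∑-++ f (k ∷ ks) ls = trans (∙-congˡ (∑-++ f ks ls)) (sym (assoc _ _ _))

    ∑-∙ : (f g : I → Carrier) → ∀ ks → ∑ (λ k → f k ∙ g k) ks ≈ ∑ f ks ∙ ∑ g ks
    ∑-∙ f g []       = sym (identityˡ ε)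
    ∑-∙ f g (k ∷ ks) = trans (∙-congˡ (∑-∙ f g ks)) (interchange _ _ _ _)

    ∑-ε : {f : I → Carrier} → (∀ k → f k ≈ ε) → ∀ ks → ∑ f ks ≈ ε
    ∑-ε f≈ε []       = refl
    ∑-ε f≈ε (k ∷ ks) = trans (∙-cong (f≈ε k) (∑-ε f≈ε ks)) (identityˡ ε)

  ∑-map : {I : Set i} {J : Set j} (f : J → Carrier) (g : I → J) →
          ∀ ks → ∑ f (map g ks) ≈ ∑ (λ k → f (g k)) ks
  ∑-map f g ks = reflexive (foldr-map _ g ε ks)

module SumHomomorphism
  (X : CommutativeMonoid x ℓx) (Y : CommutativeMonoid m ℓm)
  where

  private
    module X = CommutativeMonoid X
    module Y = CommutativeMonoid Y
    module ∑X = Sum X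
    module ∑Y = Sum Y

  ∑-homo : (h : X.Carrier → Y.Carrier) →
           h X.ε Y.≈ Y.ε → (∀ x y → h (x X.∙ y) Y.≈ h x Y.∙ h y) →
           {I : Set i} (f : I → X.Carrier) →
           ∀ ks → h (∑X.∑ f ks) Y.≈ ∑Y.∑ (λ k → h (f k)) ks
  ∑-homo h h-ε h-∙ f []       = h-ε
  ∑-homo h h-ε h-∙ f (k ∷ ks) = Y.trans (h-∙ _ _) (Y.∙-congˡ (∑-homo h h-ε h-∙ f ks))

-- Balanced maps and the universal property of the tensor product.

module _
  {A : Semiring a ℓa} {B : Semiring b ℓb} {C : Semiring c ℓc}
  (M : Bisemimodule A B m ℓm) (N : Bisemimodule B C n ℓn)
  where

  private
    module B = Semiring B
    module M = Bisemimodule M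
    module N = Bisemimodule N

  -- One field for each relation of `_∼_` that involves the module structure. The target is only a
  -- commutative monoid, since the extension is used as an additive map.
  record IsBalanced (X : CommutativeMonoid x ℓx)
                    (f : M.Carrierᴹ → N.Carrierᴹ → CommutativeMonoid.Carrier X)
                    : Set (b ⊔ m ⊔ ℓm ⊔ n ⊔ ℓn ⊔ ℓx) where
    open CommutativeMonoid X

    field
      cong     : ∀ {x x′ y y′} → x M.≈ᴹ x′ → y N.≈ᴹ y′ → f x y ≈ f x′ y′
      distribʳ : ∀ x x′ y → f (x M.+ᴹ x′) y ≈ f x y ∙ f x′ y
      distribˡ : ∀ x y y′ → f x (y N.+ᴹ y′) ≈ f x y ∙ f x y′
      zeroˡ    : ∀ y → f M.0ᴹ y ≈ ε
      zeroʳ    : ∀ x → f x N.0ᴹ ≈ ε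
      balanced : ∀ x s y → f (x M.*ᵣ s) y ≈ f x (s N.*ₗ y)

    open TensorProduct M N
    open Sum X

    extend : FormalSum → Carrier
    extend = ∑ (λ (x , y) → f x y)

    extend-[] : ∀ x y → extend [ x , y ] ≈ f x y
    extend-[] x y = identityʳ _

    -- Induction on the derivation of `xs ∼ ys`. This is how an identity between tensors becomes an
    -- identity in the target monoid.
    extend-cong : ∀ {xs ys} → xs ∼ ys → extend xs ≈ extend ys
    extend-cong ∼-refl = refl
    extend-cong (∼-sym p) = sym (extend-cong p)
    extend-cong (∼-trans p q) = trans (extend-cong p) (extend-cong q)
    extend-cong (++-cong {xs} {xs′} {ys} {ys′} p q) =
      trans (∑-++ _ xs ys)
        (trans (∙-cong (extend-cong p) (extend-cong q)) (sym (∑-++ _ xs′ ys′)))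
    extend-cong (++-comm xs ys) =
      trans (∑-++ _ xs ys) (trans (comm _ _) (sym (∑-++ _ ys xs)))
    extend-cong (⊗-cong p q) = ∙-congʳ (cong p q)
    extend-cong (⊗-distribʳ x x′ y) = trans (∙-congʳ (distribʳ x x′ y)) (assoc _ _ _)
    extend-cong (⊗-distribˡ x y y′) = trans (∙-congʳ (distribˡ x y y′)) (assoc _ _ _)
    extend-cong (⊗-zeroˡ y) = trans (identityʳ _) (zeroˡ y)
    extend-cong (⊗-zeroʳ x) = trans (identityʳ _) (zeroʳ x)
    extend-cong (⊗-balanced x s y) = ∙-congʳ (balanced x s y)

-- The pairing given by an isomorphism onto the regular bimodule.

module Pairing
  {A : Semiring a ℓa} {B : Semiring b ℓb}
  (M : Bisemimodule A B m ℓm) (N : Bisemimodule B A n ℓn)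
  (M⊗N≅A : M ⊗ N ≅ TensorUnit.bisemimodule {R = A})
  where

  private
    module M = Bisemimodule M
    module N = Bisemimodule N
    module A = Semiring A
    open TensorProduct M N
    φ = proj₁ M⊗N≅A
    module φ = IsBisemimoduleIsomorphism (proj₂ M⊗N≅A)

  ⟨_,_⟩ : M.Carrierᴹ → N.Carrierᴹ → A.Carrier
  ⟨ x , y ⟩ = φ [ x , y ]

  isBalanced : IsBalanced M N A.+-commutativeMonoid ⟨_,_⟩
  isBalanced = record
    { cong     = λ p q → φ.⟦⟧-cong (⊗-cong p q)
    ; distribʳ = λ x x′ y → A.trans (φ.⟦⟧-cong (⊗-distribʳ x x′ y)) (φ.+ᴹ-homo [ x , y ] [ x′ , y ])
    ; distribˡ = λ x y y′ → A.trans (φ.⟦⟧-cong (⊗-distribˡ x y y′)) (φ.+ᴹ-homo [ x , y ] [ x , y′ ])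
    ; zeroˡ    = λ y → A.trans (φ.⟦⟧-cong (⊗-zeroˡ y)) φ.0ᴹ-homo
    ; zeroʳ    = λ x → A.trans (φ.⟦⟧-cong (⊗-zeroʳ x)) φ.0ᴹ-homo
    ; balanced = λ x s y → φ.⟦⟧-cong (⊗-balanced x s y)
    }

  open IsBalanced isBalanced public

  *ₗ-homo : ∀ a x y → ⟨ a M.*ₗ x , y ⟩ A.≈ a A.* ⟨ x , y ⟩
  *ₗ-homo a x y = φ.*ₗ-homo a [ x , y ]

  *ᵣ-homo : ∀ a x y → ⟨ x , y N.*ᵣ a ⟩ A.≈ ⟨ x , y ⟩ A.* a
  *ᵣ-homo a x y = φ.*ᵣ-homo a [ x , y ]

  -- Supplies the pairs uⱼ, vⱼ when applied to P ⊗ Q, and qᵢ, yᵢ when applied to Q ⊗ P.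
  unit : FormalSum
  unit = proj₁ (φ.surjective A.1#)

  private
    φ-unit : φ unit A.≈ A.1#
    φ-unit = proj₂ (φ.surjective A.1#) ∼-refl

    φ≈extend : ∀ xs → φ xs A.≈ extend xs
    φ≈extend []            = φ.0ᴹ-homo
    φ≈extend ((x , y) ∷ xs) =
      A.trans (φ.+ᴹ-homo [ x , y ] xs) (A.+-congˡ (φ≈extend xs))

  extend-unit : extend unit A.≈ A.1#
  extend-unit = A.trans (A.sym (φ≈extend unit)) φ-unit

  -- The isomorphism sends both sides to `⟨ x , y ⟩`, because `unit` goes to 1, and it is injective.
  unit-·ᵣ : ∀ x y → unit ·ᵣ ⟨ x , y ⟩ ∼ [ x , y ]
  unit-·ᵣ x y = φ.injective
    (A.trans (φ.*ᵣ-homo _ unit) (A.trans (A.*-congʳ φ-unit) (A.*-identityˡ _)))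

  ·ₗ-unit : ∀ x y → ⟨ x , y ⟩ ·ₗ unit ∼ [ x , y ]
  ·ₗ-unit x y = φ.injective
    (A.trans (φ.*ₗ-homo _ unit) (A.trans (A.*-congˡ φ-unit) (A.*-identityʳ _)))

-- Elements of P are determined by their coordinates.

module Coordinates
  {A : Semiring a ℓa} {B : Semiring b ℓb}
  (P : Bisemimodule A B m ℓm) (Q : Bisemimodule B A n ℓn)
  (P⊗Q≅A : P ⊗ Q ≅ TensorUnit.bisemimodule {R = A})
  (Q⊗P≅B : Q ⊗ P ≅ TensorUnit.bisemimodule {R = B})
  where

  private
    module A = Semiring A
    module B = Semiring B
    module Q = Bisemimodule Q
    module φ = Pairing P Q P⊗Q≅A
    module ψ = Pairing Q P Q⊗P≅B
    open Bisemimodule P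
    open φ using (⟨_,_⟩)
    open ψ using () renaming (⟨_,_⟩ to ⟪_,_⟫)
    open Sum +ᴹ-commutativeMonoid
    open SetoidReasoning ≈ᴹ-setoid

    θ : Carrierᴹ → Carrierᴹ
    θ p = ∑ (λ (q , y) → ⟨ p , q ⟩ *ₗ y) ψ.unit

    η : Carrierᴹ → Carrierᴹ
    η p = ∑ (λ (u , v) → u *ᵣ ⟪ v , p ⟫) φ.unit

    θ-cong : ∀ {p p′} → p ≈ᴹ p′ → θ p ≈ᴹ θ p′
    θ-cong p≈p′ = ∑-cong (λ _ → *ₗ-congʳ (φ.cong p≈p′ Q.≈ᴹ-refl)) ψ.unit

    θ-+ : ∀ p p′ → θ (p +ᴹ p′) ≈ᴹ θ p +ᴹ θ p′
    θ-+ p p′ = ≈ᴹ-trans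
      (∑-cong (λ _ → ≈ᴹ-trans (*ₗ-congʳ (φ.distribʳ p p′ _)) (*ₗ-distribʳ _ _ _)) ψ.unit)
      (∑-∙ _ _ ψ.unit)

    θ-0 : θ 0ᴹ ≈ᴹ 0ᴹ
    θ-0 = ∑-ε (λ _ → ≈ᴹ-trans (*ₗ-congʳ (φ.zeroˡ _)) (*ₗ-zeroˡ _)) ψ.unit

    η-cong : ∀ {p p′} → p ≈ᴹ p′ → η p ≈ᴹ η p′
    η-cong p≈p′ = ∑-cong (λ _ → *ᵣ-congˡ (ψ.cong Q.≈ᴹ-refl p≈p′)) φ.unit

    η-+ : ∀ p p′ → η (p +ᴹ p′) ≈ᴹ η p +ᴹ η p′
    η-+ p p′ = ≈ᴹ-trans
      (∑-cong (λ _ → ≈ᴹ-trans (*ᵣ-congˡ (ψ.distribˡ _ p p′)) (*ᵣ-distribˡ _ _ _)) φ.unit)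
      (∑-∙ _ _ φ.unit)

    η-0 : η 0ᴹ ≈ᴹ 0ᴹ
    η-0 = ∑-ε (λ _ → ≈ᴹ-trans (*ᵣ-congˡ (ψ.zeroʳ _)) (*ᵣ-zeroʳ _)) φ.unit

    -- The extension of this map takes the value `η y` at `φ.unit`, so `η` can be computed by
    -- rewriting tensors in P ⊗ Q.
    rightActionBalanced : ∀ y → IsBalanced P Q +ᴹ-commutativeMonoid (λ u v → u *ᵣ ⟪ v , y ⟫)
    rightActionBalanced y = record
      { cong     = λ p q → *ᵣ-cong p (ψ.cong q ≈ᴹ-refl)
      ; distribʳ = λ u u′ v → *ᵣ-distribʳ _ u u′
      ; distribˡ = λ u v v′ → ≈ᴹ-trans (*ᵣ-congˡ (ψ.distribʳ v v′ y)) (*ᵣ-distribˡ u _ _)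
      ; zeroˡ    = λ v → *ᵣ-zeroˡ _
      ; zeroʳ    = λ u → ≈ᴹ-trans (*ᵣ-congˡ (ψ.zeroˡ y)) (*ᵣ-zeroʳ u)
      ; balanced = λ u s v → ≈ᴹ-trans (*ᵣ-assoc u s _) (*ᵣ-congˡ (B.sym (ψ.*ₗ-homo s v y)))
      }

    -- Likewise the extension takes the value `θ u` at `ψ.unit`.
    leftActionBalanced : ∀ u → IsBalanced Q P +ᴹ-commutativeMonoid (λ v y → ⟨ u , v ⟩ *ₗ y)
    leftActionBalanced u = record
      { cong     = λ p q → *ₗ-cong (φ.cong ≈ᴹ-refl p) q
      ; distribʳ = λ v v′ y → ≈ᴹ-trans (*ₗ-congʳ (φ.distribˡ u v v′)) (*ₗ-distribʳ y _ _)
      ; distribˡ = λ v y y′ → *ₗ-distribˡ _ y y′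
      ; zeroˡ    = λ y → ≈ᴹ-trans (*ₗ-congʳ (φ.zeroʳ u)) (*ₗ-zeroˡ y)
      ; zeroʳ    = λ v → *ₗ-zeroʳ _
      ; balanced = λ v k y → ≈ᴹ-trans (*ₗ-congʳ (φ.*ᵣ-homo k u v)) (*ₗ-assoc _ k y)
      }

    -- The scalar `⟨ p , q ⟩` moves across the pairing of Q with P onto the second entries of
    -- `φ.unit`, which then collapses to p ⊗ q. No compatibility between the two pairings enters.
    η-term : ∀ p q y → η (⟨ p , q ⟩ *ₗ y) ≈ᴹ p *ᵣ ⟪ q , y ⟫
    η-term p q y = begin
      η (⟨ p , q ⟩ *ₗ y)
        ≈⟨ ∑-cong (λ _ → *ᵣ-congˡ (ψ.balanced _ _ y)) φ.unit ⟨
      ∑ (λ (u , v) → u *ᵣ ⟪ v Q.*ᵣ ⟨ p , q ⟩ , y ⟫) φ.unit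
        ≈⟨ ∑-map _ (map₂ (Q._*ᵣ ⟨ p , q ⟩)) φ.unit ⟨
      extend (TensorProduct._·ᵣ_ P Q φ.unit ⟨ p , q ⟩)
        ≈⟨ extend-cong (φ.unit-·ᵣ p q) ⟩
      extend [ p , q ]
        ≈⟨ extend-[] p q ⟩
      p *ᵣ ⟪ q , y ⟫
        ∎
      where open IsBalanced (rightActionBalanced y)

    -- Mirror image of `η-term`: the scalar `⟪ v , p ⟫` moves onto the first entries of `ψ.unit`,
    -- which collapses to v ⊗ p.
    θ-term : ∀ u v p → θ (u *ᵣ ⟪ v , p ⟫) ≈ᴹ ⟨ u , v ⟩ *ₗ p
    θ-term u v p = begin
      θ (u *ᵣ ⟪ v , p ⟫)
        ≈⟨ ∑-cong (λ _ → *ₗ-congʳ (φ.balanced u _ _)) ψ.unit ⟩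
      ∑ (λ (q , y) → ⟨ u , ⟪ v , p ⟫ Q.*ₗ q ⟩ *ₗ y) ψ.unit
        ≈⟨ ∑-map _ (map₁ (⟪ v , p ⟫ Q.*ₗ_)) ψ.unit ⟨
      extend (TensorProduct._·ₗ_ Q P ⟪ v , p ⟫ ψ.unit)
        ≈⟨ extend-cong (ψ.·ₗ-unit v p) ⟩
      extend [ v , p ]
        ≈⟨ extend-[] v p ⟩
      ⟨ u , v ⟩ *ₗ p
        ∎
      where open IsBalanced (leftActionBalanced u)

    η∘θ : ∀ p → η (θ p) ≈ᴹ p
    η∘θ p = begin
      η (θ p)
        ≈⟨ SumHomomorphism.∑-homo +ᴹ-commutativeMonoid +ᴹ-commutativeMonoid η η-0 η-+ _ ψ.unit ⟩
      ∑ (λ (q , y) → η (⟨ p , q ⟩ *ₗ y)) ψ.unit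
        ≈⟨ ∑-cong (λ (q , y) → η-term p q y) ψ.unit ⟩
      ∑ (λ (q , y) → p *ᵣ ⟪ q , y ⟫) ψ.unit
        -- Every term now has the factor `p` on the left; what remains is the sum of the ⟪qᵢ,yᵢ⟫,
        -- which is 1.
        ≈⟨ SumHomomorphism.∑-homo B.+-commutativeMonoid +ᴹ-commutativeMonoid
             (p *ᵣ_) (*ᵣ-zeroʳ p) (*ᵣ-distribˡ p) _ ψ.unit ⟨
      p *ᵣ ψ.extend ψ.unit
        ≈⟨ *ᵣ-congˡ ψ.extend-unit ⟩
      p *ᵣ B.1#
        ≈⟨ *ᵣ-identityʳ p ⟩
      p ∎

    θ∘η : ∀ p → θ (η p) ≈ᴹ p
    θ∘η p = begin
      θ (η p)
        ≈⟨ SumHomomorphism.∑-homo +ᴹ-commutativeMonoid +ᴹ-commutativeMonoid θ θ-0 θ-+ _ φ.unit ⟩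
      ∑ (λ (u , v) → θ (u *ᵣ ⟪ v , p ⟫)) φ.unit
        ≈⟨ ∑-cong (λ (u , v) → θ-term u v p) φ.unit ⟩
      ∑ (λ (u , v) → ⟨ u , v ⟩ *ₗ p) φ.unit
        ≈⟨ SumHomomorphism.∑-homo A.+-commutativeMonoid +ᴹ-commutativeMonoid
             (_*ₗ p) (*ₗ-zeroˡ p) (*ₗ-distribʳ p) _ φ.unit ⟨
      φ.extend φ.unit *ₗ p
        ≈⟨ *ₗ-congʳ φ.extend-unit ⟩
      A.1# *ₗ p
        ≈⟨ *ₗ-identityˡ p ⟩
      p ∎

  -- `θ p` is built from the values `⟨ p , q ⟩` alone, and `η` recovers `p` from it.
  ⟨-,q⟩-jointly-injective : ∀ {p p′} → (∀ q → ⟨ p , q ⟩ A.≈ ⟨ p′ , q ⟩) → p ≈ᴹ p′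
  ⟨-,q⟩-jointly-injective {p} {p′} eq = begin
    p         ≈⟨ η∘θ p ⟨
    η (θ p)   ≈⟨ η-cong (∑-cong (λ (q , _) → *ₗ-congʳ (eq q)) ψ.unit) ⟩
    η (θ p′)  ≈⟨ η∘θ p′ ⟩
    p′        ∎

  -- Here `η p` carries the coordinates and `θ` recovers `p`, so the other composite is used.
  ⟪v,-⟫-jointly-injective : ∀ {p p′} → (∀ v → ⟪ v , p ⟫ B.≈ ⟪ v , p′ ⟫) → p ≈ᴹ p′
  ⟪v,-⟫-jointly-injective {p} {p′} eq = begin
    p         ≈⟨ θ∘η p ⟨
    θ (η p)   ≈⟨ θ-cong (∑-cong (λ (_ , v) → *ᵣ-congˡ (eq v)) φ.unit) ⟩
    θ (η p′)  ≈⟨ θ∘η p′ ⟩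
    p′        ∎

-- A Kleene algebra as a Kleene module over itself.

module _ (K : KleeneAlgebra a ℓa) where
  open KleeneAlgebra K

  private
    x+y≤x : ∀ {x y} → y ≤ x → x + y ≤ x
    x+y≤x {x} {y} y≤x = trans (+-assoc x y x) (trans (+-congˡ y≤x) (+-idem x))

  -- Star induction with base and bound both equal to `m`; idempotence turns xm ≤ m into its premise
  -- m + xm ≤ m.
  regular-isLeftKleeneModule : IsLeftKleeneModule K (TensorUnit.leftSemimodule {R = semiring})
  regular-isLeftKleeneModule x m xm≤m = ⋆-inductˡ m x m (x+y≤x xm≤m)

  regular-isRightKleeneModule : IsRightKleeneModule K (TensorUnit.rightSemimodule {R = semiring})
  regular-isRightKleeneModule x m mx≤m = ⋆-inductʳ m x m (x+y≤x mx≤m)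

-- Transfer of the Kleene laws to P.

module _
  (K : KleeneAlgebra a ℓa) (S : KleeneAlgebra b ℓb)
  (P : Bisemimodule (KleeneAlgebra.semiring K) (KleeneAlgebra.semiring S) m ℓm)
  (Q : Bisemimodule (KleeneAlgebra.semiring S) (KleeneAlgebra.semiring K) n ℓn)
  (P⊗Q≅K : P ⊗ Q ≅ TensorUnit.bisemimodule {R = KleeneAlgebra.semiring K})
  (Q⊗P≅S : Q ⊗ P ≅ TensorUnit.bisemimodule {R = KleeneAlgebra.semiring S})
  where

  private
    module K = KleeneAlgebra K
    module S = KleeneAlgebra S
    module Q = Bisemimodule Q
    module φ = Pairing P Q P⊗Q≅K
    module ψ = Pairing Q P Q⊗P≅S
    open Bisemimodule P
    open Coordinates P Q P⊗Q≅K Q⊗P≅S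

    -- Since kp ≤ p abbreviates kp + p = p, this translates that inequality into one in K between
    -- coordinates; it serves for both k and its star.
    ⟨kp+p,q⟩ : ∀ k p q → φ.⟨ k *ₗ p +ᴹ p , q ⟩ K.≈ k K.* φ.⟨ p , q ⟩ K.+ φ.⟨ p , q ⟩
    ⟨kp+p,q⟩ k p q = K.trans (φ.distribʳ (k *ₗ p) p q) (K.+-congʳ (φ.*ₗ-homo k p q))

    ⟪v,ps+p⟫ : ∀ s v p → ψ.⟨ v , p *ᵣ s +ᴹ p ⟩ S.≈ ψ.⟨ v , p ⟩ S.* s S.+ ψ.⟨ v , p ⟩
    ⟪v,ps+p⟫ s v p = S.trans (ψ.distribˡ v (p *ᵣ s) p) (S.+-congʳ (ψ.*ᵣ-homo s v p))

  moritaKleeneBimodule : KleeneBimodule K S m ℓm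
  moritaKleeneBimodule = record
    { bisemimodule = P
    -- The conclusion is an equation in P, so it may be checked on each coordinate, where it is the
    -- left law of K over itself.
    ; isLeftKleeneModule = λ k p kp≤p → ⟨-,q⟩-jointly-injective λ q →
        K.trans (⟨kp+p,q⟩ (k K.⋆) p q)
          (regular-isLeftKleeneModule K k φ.⟨ p , q ⟩
            (K.trans (K.sym (⟨kp+p,q⟩ k p q)) (φ.cong kp≤p Q.≈ᴹ-refl)))
    -- The coordinates are now the right S-linear ones, with values in S.
    ; isRightKleeneModule = λ s p ps≤p → ⟪v,-⟫-jointly-injective λ v →
        S.trans (⟪v,ps+p⟫ (s S.⋆) v p)
          (regular-isRightKleeneModule S s ψ.⟨ v , p ⟩
            (S.trans (S.sym (⟪v,ps+p⟫ s v p)) (ψ.cong Q.≈ᴹ-refl ps≤p)))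
    }

theorem22 : ∀ {k ℓk s ℓs p ℓp q ℓq : Level}
    (K : KleeneAlgebra k ℓk) (S : KleeneAlgebra s ℓs) →
    let module K = KleeneAlgebra K
        module S = KleeneAlgebra S
    in
    (Σ[ P ∈ Bisemimodule K.semiring S.semiring p ℓp ]
     Σ[ Q ∈ Bisemimodule S.semiring K.semiring q ℓq ]
       (P ⊗ Q ≅ TensorUnit.bisemimodule {R = K.semiring})
       × (Q ⊗ P ≅ TensorUnit.bisemimodule {R = S.semiring})) →
    (Σ[ M ∈ KleeneBimodule K S p ℓp ]
     Σ[ N ∈ KleeneBimodule S K q ℓq ]
       (KleeneBimodule.bisemimodule M ⊗ KleeneBimodule.bisemimodule N
         ≅ TensorUnit.bisemimodule {R = K.semiring})
       × (KleeneBimodule.bisemimodule N ⊗ KleeneBimodule.bisemimodule M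
         ≅ TensorUnit.bisemimodule {R = S.semiring}))
theorem22 K S (P , Q , P⊗Q≅K , Q⊗P≅S) =
  moritaKleeneBimodule K S P Q P⊗Q≅K Q⊗P≅S ,
  moritaKleeneBimodule S K Q P Q⊗P≅S P⊗Q≅K ,
  P⊗Q≅K , Q⊗P≅S
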